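{- If a term rewrite system $\mathcal{R}$ is non-overlapping, then the parallel-innermost rewrite relation $\Rightarrow_{\mathcal{R}}$ is deterministic and hence confluent.
   Context: Terms and rewriting. $\mathcal{T}(\Sigma,\mathcal{V})$ is the set of first-order terms over a finite signature $\Sigma$ and variables $\mathcal{V}$. $t|_\pi$ is the subterm of $t$ at position $\pi$ ($\varepsilon$ is the root position), $t[s]_\pi$ is $t$ with that subterm replaced by $s$. A term rewrite system (TRS) $\mathcal{R}$ is a finite set of rules $\ell \to r$ with $\ell,r$ terms, $\ell \notin \mathcal{V}$ and $\mathcal{V}(r) \subseteq \mathcal{V}(\ell)$ (where $\mathcal{V}(t)$ is the set of variables of $t$). $s \to_{\mathcal{R}} t$ iff $s|_\pi = \ell\sigma$ and $t = s[r\sigma]_\pi$ for some $\ell\to r\in\mathcal{R}$, position $\pi$ of $s$ and substitution $\sigma$; $\ell\sigma$ is the redex. It is an innermost redex if no proper subterm of it is a redex, and then the step is an innermost step, written $s \xrightarrow{\mathsf{i}}_{\mathcal{R}} t$. Parallel-innermost rewriting $\Rightarrow_{\mathcal{R}}$ (all innermost redexes are rewritten simultaneously): $s \Rightarrow_{\mathcal{R}} t$ iff $s \xrightarrow{\mathsf{i}}{}^{+}_{\mathcal{R}} t$ and either (a) $s \xrightarrow{\mathsf{i}}_{\mathcal{R}} t$ with $s$ an innermost redex, or (b) $s=f(s_1,\ldots,s_n)$, $t=f(t_1,\ldots,t_n)$, and for all $1\le k\le n$ either $s_k\Rightarrow_{\mathcal{R}} t_k$ or $s_k=t_k$ is a normal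 form. A relation $\to$ is deterministic iff for every $s$ there is at most one $t$ with $s\to t$; it is confluent iff $s\to^* t$ and $s\to^* u$ imply there is $v$ with $t\to^* v$ and $u\to^* v$. Critical pairs: let $\ell\to r,\ u\to v\in\mathcal{R}$ be rules whose variables have been renamed apart and let $\pi$ be a position in $u$ such that $u|_\pi\notin\mathcal{V}$. If $\pi=\varepsilon$, it is required that $\ell\to r$ and $u\to v$ are not variants of the same rule (i.e., are not equal up to renaming of variables). If $\ell$ and $u|_\pi$ unify with most general unifier $\sigma$, then the pair of terms $u\sigma[r\sigma]_\pi\rtimes v\sigma$ is a critical pair of $\mathcal{R}$. $\mathcal{R}$ is non-overlapping iff it has no critical pairs.
   Formalization: Clause (b) of parallel-innermost rewriting additionally requires that s is not itself an innermost redex; as printed the claim fails for {a → b, b → a}, where a ⇒ b by (a) and a ⇒ a by (b) with no arguments. -}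

module Defs where

open import Data.Fin using (Fin)
open import Data.List using (List; []; _∷_)
open import Data.List.Membership.Propositional using (_∈_; _∉_)
open import Data.List.Relation.Unary.All using (All)
open import Data.Maybe using (Maybe; just; nothing)
open import Data.Nat using (ℕ; zero; suc)
open import Data.Product using (_×_; ∃; Σ-syntax; ∃-syntax)
open import Data.Sum using (_⊎_)
open import Data.Vec using (Vec; []; _∷_; lookup)
open import Function using (_∘_)
open import Function.Bundles using (_↔_; Inverse)
open import Relation.Binary.Construct.Closure.Transitive using (TransClosure)
open import Relation.Binary.Definitions using (DecidableEquality)
open import Relation.Binary.PropositionalEquality using (_≡_; _≢_)
open import Relation.Binary.Rewriting using (IsNormalForm)
open import Relation.Nullary using (¬_)

-- A finite signature: the function symbols are Fin size.
record Signature : Set where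
  field
    size  : ℕ
    arity : Fin size → ℕ

-- An infinite set of variables: outside any finite list there is another
-- variable, so that rules can always be renamed apart.
record Variables : Set₁ where
  field
    Carrier : Set
    _≟_     : DecidableEquality Carrier
    fresh   : (xs : List Carrier) → ∃[ x ] x ∉ xs

module Rewriting (Sg : Signature) (Var : Variables) where

  open Signature Sg
  open Variables Var using () renaming (Carrier to 𝒱)

  data Term : Set where
    var : 𝒱 → Term
    fun : (f : Fin size) → Vec Term (arity f) → Term

  IsVar : Term → Set
  IsVar t = ∃[ x ] t ≡ var x

  infix 4 _∈V_
  data _∈V_ (x : 𝒱) : Term → Set where
    here  : x ∈V var x
    there : ∀ {f ts} (i : Fin (arity f)) → x ∈V lookup ts i → x ∈V fun f ts

  Subst : Set
  Subst = 𝒱 → Term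

  infixl 8 _·_ _·*_
  mutual
    _·_ : Term → Subst → Term
    var x    · σ = σ x
    fun f ts · σ = fun f (ts ·* σ)

    _·*_ : ∀ {n} → Vec Term n → Subst → Vec Term n
    []       ·* σ = []
    (t ∷ ts) ·* σ = t · σ ∷ ts ·* σ

  -- [] is the root position; arguments are numbered from 0.
  Position : Set
  Position = List ℕ

  -- t ∣ π is nothing exactly when π is not a position of t.
  infix 7 _∣_
  mutual
    _∣_ : Term → Position → Maybe Term
    t        ∣ []      = just t
    var x    ∣ (i ∷ π) = nothing
    fun f ts ∣ (i ∷ π) = subtermArg ts i π

    subtermArg : ∀ {n} → Vec Term n → ℕ → Position → Maybe Term
    subtermArg []       i       π = nothing
    subtermArg (t ∷ ts) zero    π = t ∣ π
    subtermArg (t ∷ ts) (suc i) π = subtermArg ts i π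

  -- t [ s ] π leaves t unchanged when π is not a position of t; below it is
  -- only used at positions of t.
  infix 7 _[_]_
  mutual
    _[_]_ : Term → Term → Position → Term
    t        [ s ] []      = s
    var x    [ s ] (i ∷ π) = var x
    fun f ts [ s ] (i ∷ π) = fun f (replaceArg ts s i π)

    replaceArg : ∀ {n} → Vec Term n → Term → ℕ → Position → Vec Term n
    replaceArg []       s i       π = []
    replaceArg (t ∷ ts) s zero    π = t [ s ] π ∷ ts
    replaceArg (t ∷ ts) s (suc i) π = t ∷ replaceArg ts s i π

  infix 5 _⟶_
  record Rule : Set where
    constructor _⟶_
    field
      lhs : Term
      rhs : Term

  record WellFormed (ρ : Rule) : Set where
    open Rule ρ
    field
      lhs-nonvar : ¬ IsVar lhs
      rhs-vars   : ∀ x → x ∈V rhs → x ∈V lhs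

  record TRS : Set where
    field
      rules      : List Rule
      wellFormed : All WellFormed rules

  open TRS public

  Redex : TRS → Term → Set
  Redex R s = Σ[ ρ ∈ Rule ] ∃[ σ ] ρ ∈ rules R × s ≡ Rule.lhs ρ · σ

  InnermostRedex : TRS → Term → Set
  InnermostRedex R s =
    Redex R s × (∀ π w → π ≢ [] → s ∣ π ≡ just w → ¬ Redex R w)

  data Step (R : TRS) (s t : Term) : Set where
    step : ∀ {ℓ r} π σ → (ℓ ⟶ r) ∈ rules R →
           s ∣ π ≡ just (ℓ · σ) → t ≡ s [ r · σ ] π → Step R s t

  data InnermostStep (R : TRS) (s t : Term) : Set where
    step : ∀ {ℓ r} π σ → (ℓ ⟶ r) ∈ rules R →
           s ∣ π ≡ just (ℓ · σ) → InnermostRedex R (ℓ · σ) →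
           t ≡ s [ r · σ ] π → InnermostStep R s t

  -- All innermost redexes are rewritten simultaneously.  The alternatives root
  -- and args are exclusive: args requires that s is not itself an innermost
  -- redex.  Without this, in the non-overlapping system {a → b, b → a} over
  -- constants a, b both a ⇒ b (by root) and a ⇒ a (by args, vacuously, as
  -- a → b → a is a nonempty innermost sequence) would hold, although a ⇒ a
  -- leaves the innermost redex a unrewritten.
  data ParInnermost (R : TRS) : Term → Term → Set where
    root : ∀ {s t} → TransClosure (InnermostStep R) s t →
           InnermostRedex R s → InnermostStep R s t → ParInnermost R s t
    args : ∀ {f} {ss ts : Vec Term (arity f)} →
           TransClosure (InnermostStep R) (fun f ss) (fun f ts) →
           ¬ InnermostRedex R (fun f ss) →
           (∀ k → ParInnermost R (lookup ss k) (lookup ts k)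
                ⊎ (lookup ss k ≡ lookup ts k
                   × IsNormalForm (Step R) (lookup ss k))) →
           ParInnermost R (fun f ss) (fun f ts)

  Renaming : Set
  Renaming = 𝒱 ↔ 𝒱

  rename : Renaming → Term → Term
  rename ρ t = t · (var ∘ Inverse.to ρ)

  Variant : Rule → Rule → Set
  Variant (ℓ ⟶ r) (u ⟶ v) =
    Σ[ ρ ∈ Renaming ] u ≡ rename ρ ℓ × v ≡ rename ρ r

  VariantOfRule : TRS → Rule → Set
  VariantOfRule R ρ = Σ[ ρ′ ∈ Rule ] ρ′ ∈ rules R × Variant ρ′ ρ

  infix 4 _∈Vᴿ_
  _∈Vᴿ_ : 𝒱 → Rule → Set
  x ∈Vᴿ (ℓ ⟶ r) = x ∈V ℓ ⊎ x ∈V r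

  VariableDisjoint : Rule → Rule → Set
  VariableDisjoint ρ₁ ρ₂ = ∀ x → x ∈Vᴿ ρ₁ → ¬ (x ∈Vᴿ ρ₂)

  Unifier : Subst → Term → Term → Set
  Unifier σ s t = s · σ ≡ t · σ

  MGU : Subst → Term → Term → Set
  MGU σ s t =
    Unifier σ s t ×
    (∀ τ → Unifier τ s t → Σ[ δ ∈ Subst ] (∀ x → τ x ≡ σ x · δ))

  data CriticalPair (R : TRS) : Term → Term → Set where
    critical : ∀ {ℓ r u v w π σ} →
      VariantOfRule R (ℓ ⟶ r) → VariantOfRule R (u ⟶ v) →
      VariableDisjoint (ℓ ⟶ r) (u ⟶ v) →
      u ∣ π ≡ just w → ¬ IsVar w →
      (π ≡ [] → ¬ Variant (ℓ ⟶ r) (u ⟶ v)) →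
      MGU σ ℓ w →
      CriticalPair R ((u · σ) [ r · σ ] π) (v · σ)

  NonOverlapping : TRS → Set
  NonOverlapping R = ∀ p q → ¬ CriticalPair R p q

{-# OPTIONS --safe #-}
-- Two root steps of an innermost redex s = ℓσ = uτ by rules ℓ → r and u → v have
-- the same result: if the rules are variants, then because V(r) ⊆ V(ℓ); and
-- otherwise σ and τ would show that ℓ, renamed apart, unifies with u, which gives
-- a critical pair.  Determinism follows by induction on the term, since normal
-- forms admit no parallel step.
--
-- The most general unifier is computed by the usual elimination procedure.  As
-- some unifier is known from the start, the size of the instantiated equations
-- can serve as the termination measure, and the occurs check always succeeds.
module Submission where

open import Data.Fin as Fin using (Fin; zero; suc)
open import Data.List using (List; []; _∷_; _++_; map)
open import Data.List.Membership.Propositional using (_∈_; _∉_)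
open import Data.List.Membership.Propositional.Properties
  using (∈-++⁺ˡ; ∈-++⁺ʳ; ∈-map⁺)
import Data.List.Membership.DecPropositional as DecMembership
open import Data.List.Relation.Unary.All as All using (All; []; _∷_)
import Data.List.Relation.Unary.All.Properties as All
import Data.List.Relation.Unary.Any as Any
open import Data.Nat using (ℕ; suc; _+_; _≤_; _<_; z<s; s≤s; s≤s⁻¹)
open import Data.Nat.Properties
  using (≤-refl; ≤-trans; ≤-reflexive; ≤-<-trans; <-≤-trans; <-irrefl; m≤m+n;
         m≤n+m; m<n+m; n≤1+n; +-assoc)
open import Data.Product using (_×_; _,_; proj₂; ∃; Σ-syntax; ∃-syntax)
open import Data.Sum using (inj₁; inj₂; [_,_]′)
open import Data.Vec as Vec using (Vec; []; _∷_; lookup)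
open import Data.Vec.Relation.Binary.Pointwise.Extensional
  using (ext; Pointwise-≡⇒≡)
open import Function using (_∘_)
open import Function.Bundles using (Inverse; mk↔ₛ′)
open import Function.Properties.Inverse using (↔-refl; ↔-trans)
open import Relation.Binary.Construct.Closure.Transitive
  using (TransClosure; [_]; _∷_)
open import Relation.Binary.Definitions using (DecidableEquality)
open import Relation.Binary.PropositionalEquality
  using (_≡_; _≢_; refl; sym; trans; cong; cong₂; subst; module ≡-Reasoning)
open import Relation.Binary.Rewriting
  using (Deterministic; Confluent; IsNormalForm; det⇒conf)
open import Relation.Nullary using (¬_; yes; no; contradiction)
open import Relation.Nullary.Decidable using (decidable-stable; map′; _×-dec_)
open import Defs

module _ (Sg : Signature) (Var : Variables) where

  open Signature Sg hiding (size)
  open Variables Var using (_≟_; fresh) renaming (Carrier to 𝒱)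
  open Rewriting Sg Var
  open DecMembership _≟_ using (_∈?_)

  -- Decidable equality of terms

  var-injective : ∀ {x y} → var x ≡ var y → x ≡ y
  var-injective refl = refl

  fun-injective : ∀ {f ts us} → fun f ts ≡ fun f us → ts ≡ us
  fun-injective refl = refl

  mutual
    _≟ₜ_ : DecidableEquality Term
    var x    ≟ₜ var y    = map′ (cong var) var-injective (x ≟ y)
    var x    ≟ₜ fun g us = no λ()
    fun f ts ≟ₜ var y    = no λ()
    fun f ts ≟ₜ fun g us with f Fin.≟ g
    ... | yes refl = map′ (cong (fun f)) fun-injective (ts ≟ₜ* us)
    ... | no  f≢g  = no λ { refl → f≢g refl }

    _≟ₜ*_ : ∀ {n} → DecidableEquality (Vec Term n)
    []       ≟ₜ* []       = yes refl
    (t ∷ ts) ≟ₜ* (u ∷ us) =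
      map′ (λ (p , q) → cong₂ _∷_ p q) (λ { refl → refl , refl })
           ((t ≟ₜ u) ×-dec (ts ≟ₜ* us))

  -- Substitutions

  lookup-·* : ∀ {n} (ts : Vec Term n) σ i → lookup (ts ·* σ) i ≡ lookup ts i · σ
  lookup-·* (t ∷ ts) σ zero    = refl
  lookup-·* (t ∷ ts) σ (suc i) = lookup-·* ts σ i

  infixl 8 _⨟_
  _⨟_ : Subst → Subst → Subst
  (σ ⨟ τ) x = σ x · τ

  mutual
    ·-⨟ : ∀ t σ τ → t · σ · τ ≡ t · (σ ⨟ τ)
    ·-⨟ (var x)    σ τ = refl
    ·-⨟ (fun f ts) σ τ = cong (fun f) (·*-⨟ ts σ τ)

    ·*-⨟ : ∀ {n} (ts : Vec Term n) σ τ → ts ·* σ ·* τ ≡ ts ·* (σ ⨟ τ)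
    ·*-⨟ []       σ τ = refl
    ·*-⨟ (t ∷ ts) σ τ = cong₂ _∷_ (·-⨟ t σ τ) (·*-⨟ ts σ τ)

  mutual
    ·-var : ∀ t → t · var ≡ t
    ·-var (var x)    = refl
    ·-var (fun f ts) = cong (fun f) (·*-var ts)

    ·*-var : ∀ {n} (ts : Vec Term n) → ts ·* var ≡ ts
    ·*-var []       = refl
    ·*-var (t ∷ ts) = cong₂ _∷_ (·-var t) (·*-var ts)

  mutual
    ·-cong : ∀ t {σ τ} → (∀ x → x ∈V t → σ x ≡ τ x) → t · σ ≡ t · τ
    ·-cong (var x)    σ≗τ = σ≗τ x here
    ·-cong (fun f ts) σ≗τ = cong (fun f) (·*-cong ts λ i x p → σ≗τ x (there i p))

    ·*-cong : ∀ {n} (ts : Vec Term n) {σ τ} →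
              (∀ i x → x ∈V lookup ts i → σ x ≡ τ x) → ts ·* σ ≡ ts ·* τ
    ·*-cong []       σ≗τ = refl
    ·*-cong (t ∷ ts) σ≗τ =
      cong₂ _∷_ (·-cong t (σ≗τ zero)) (·*-cong ts λ i → σ≗τ (suc i))

  -- Equal instances of `fun f ts` have equal arguments, so the equality descends to any occurrence
  -- of `x` in `t`.
  ·-cong⁻¹ : ∀ {t σ τ} → t · σ ≡ t · τ → ∀ x → x ∈V t → σ x ≡ τ x
  ·-cong⁻¹ eq x here = eq
  ·-cong⁻¹ {fun f ts} {σ} {τ} eq x (there i x∈tᵢ) = ·-cong⁻¹ tᵢσ≡tᵢτ x x∈tᵢ
    where
    tᵢσ≡tᵢτ : lookup ts i · σ ≡ lookup ts i · τ
    tᵢσ≡tᵢτ = trans (sym (lookup-·* ts σ i))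
      (trans (cong (λ us → lookup us i) (fun-injective eq)) (lookup-·* ts τ i))

  -- Variables and size of a term

  mutual
    vars : Term → List 𝒱
    vars (var x)    = x ∷ []
    vars (fun f ts) = vars* ts

    vars* : ∀ {n} → Vec Term n → List 𝒱
    vars* []       = []
    vars* (t ∷ ts) = vars t ++ vars* ts

  mutual
    ∈V⇒∈vars : ∀ {x t} → x ∈V t → x ∈ vars t
    ∈V⇒∈vars here                        = Any.here refl
    ∈V⇒∈vars {t = fun f ts} (there i x∈) = ∈V⇒∈vars* ts i x∈

    ∈V⇒∈vars* : ∀ {n x} (ts : Vec Term n) i → x ∈V lookup ts i → x ∈ vars* ts
    ∈V⇒∈vars* (t ∷ ts) zero    x∈ = ∈-++⁺ˡ (∈V⇒∈vars x∈)
    ∈V⇒∈vars* (t ∷ ts) (suc i) x∈ = ∈-++⁺ʳ (vars t) (∈V⇒∈vars* ts i x∈)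

  ruleVars : Rule → List 𝒱
  ruleVars (ℓ ⟶ r) = vars ℓ ++ vars r

  ∈Vᴿ⇒∈ruleVars : ∀ {x} ρ → x ∈Vᴿ ρ → x ∈ ruleVars ρ
  ∈Vᴿ⇒∈ruleVars (ℓ ⟶ r) =
    [ ∈-++⁺ˡ ∘ ∈V⇒∈vars , ∈-++⁺ʳ (vars ℓ) ∘ ∈V⇒∈vars ]′

  mutual
    size : Term → ℕ
    size (var x)    = 1
    size (fun f ts) = suc (size* ts)

    size* : ∀ {n} → Vec Term n → ℕ
    size* []       = 0
    size* (t ∷ ts) = size t + size* ts

  size>0 : ∀ t → 0 < size t
  size>0 (var x)    = z<s
  size>0 (fun f ts) = z<s

  mutual
    size-∈V : ∀ {x t} τ → x ∈V t → size (τ x) ≤ size (t · τ)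
    size-∈V τ here                         = ≤-refl
    size-∈V {t = fun f ts} τ (there i x∈) =
      ≤-trans (size-∈V* τ ts i x∈) (n≤1+n _)

    size-∈V* : ∀ {n x} τ (ts : Vec Term n) i → x ∈V lookup ts i →
               size (τ x) ≤ size* (ts ·* τ)
    size-∈V* τ (t ∷ ts) zero    x∈ = ≤-trans (size-∈V τ x∈) (m≤m+n _ _)
    size-∈V* τ (t ∷ ts) (suc i) x∈ = ≤-trans (size-∈V* τ ts i x∈) (m≤n+m _ _)

  -- Occurs check: otherwise `τ x` would sit strictly below the root of an instance equal to it, and
  -- so be smaller than itself.
  unifier⇒∉V : ∀ {x f ts} τ → Unifier τ (var x) (fun f ts) → ¬ (x ∈V fun f ts)
  unifier⇒∉V {ts = ts} τ eq (there i x∈) =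
    <-irrefl (cong size eq) (s≤s (size-∈V* τ ts i x∈))

  -- Unification

  Equation : Set
  Equation = Term × Term

  Solves : Subst → Equation → Set
  Solves σ (s , t) = Unifier σ s t

  Unifies : Subst → List Equation → Set
  Unifies σ = All (Solves σ)

  infix 4 _Absorbs_
  _Absorbs_ : Subst → Subst → Set
  τ Absorbs σ = ∀ x → τ x ≡ σ x · τ

  absorbs-· : ∀ {σ τ} → τ Absorbs σ → ∀ t → t · σ · τ ≡ t · τ
  absorbs-· {σ} {τ} abs t = trans (·-⨟ t σ τ) (·-cong t λ x _ → sym (abs x))

  -- Stronger than `MGU`: each unifier factors through `mgu` with itself as the factor. Applied to
  -- `mgu`, this is idempotence; and no separate factor has to be tracked through the recursion.
  record IdempotentMGU (E : List Equation) : Set where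
    constructor idempotentMGU
    field
      mgu         : Subst
      unifies     : Unifies mgu E
      mostGeneral : ∀ τ → Unifies τ E → τ Absorbs mgu

  open IdempotentMGU

  IdempotentMGU-resp : ∀ {E E′} → (∀ {σ} → Unifies σ E → Unifies σ E′) →
                       (∀ {σ} → Unifies σ E′ → Unifies σ E) →
                       IdempotentMGU E → IdempotentMGU E′
  IdempotentMGU-resp to from (idempotentMGU σ u g) =
    idempotentMGU σ (to u) (λ τ → g τ ∘ from)

  flipHead : ∀ {s t E σ} → Unifies σ ((s , t) ∷ E) → Unifies σ ((t , s) ∷ E)
  flipHead (p ∷ ps) = sym p ∷ ps

  infix 9 _↦_
  _↦_ : 𝒱 → Term → Subst
  (x ↦ t) y with x ≟ y
  ... | yes _ = t
  ... | no  _ = var y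

  ↦-≡ : ∀ x t → (x ↦ t) x ≡ t
  ↦-≡ x t with x ≟ x
  ... | yes _   = refl
  ... | no  x≢x = contradiction refl x≢x

  ↦-≢ : ∀ {x y} t → x ≢ y → (x ↦ t) y ≡ var y
  ↦-≢ {x} {y} t x≢y with x ≟ y
  ... | yes x≡y = contradiction x≡y x≢y
  ... | no  _   = refl

  ·-↦-∉V : ∀ {x} t → ¬ (x ∈V t) → t · x ↦ t ≡ t
  ·-↦-∉V {x} t x∉t =
    trans (·-cong t λ y y∈t → ↦-≢ t λ { refl → x∉t y∈t }) (·-var t)

  absorbs-↦ : ∀ {x t} τ → τ x ≡ t · τ → τ Absorbs x ↦ t
  absorbs-↦ {x} τ eq y with x ≟ y
  ... | yes refl = eq
  ... | no  _    = refl

  substEq : Subst → Equation → Equation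
  substEq θ (s , t) = s · θ , t · θ

  unifies-subst⁺ : ∀ {θ τ E} → τ Absorbs θ → Unifies τ E →
                   Unifies τ (map (substEq θ) E)
  unifies-subst⁺ abs []                  = []
  unifies-subst⁺ abs (_∷_ {s , t} p ps) =
    trans (absorbs-· abs s) (trans p (sym (absorbs-· abs t)))
      ∷ unifies-subst⁺ abs ps

  unifies-subst⁻ : ∀ {θ σ E} → Unifies σ (map (substEq θ) E) → Unifies (θ ⨟ σ) E
  unifies-subst⁻ {θ} {σ} u =
    All.map (λ { {s , t} p → trans (sym (·-⨟ s θ σ)) (trans p (·-⨟ t θ σ)) })
            (All.map⁻ u)

  -- The composite solves the head equation because `x ↦ t` fixes `t`. A unifier of the whole system
  -- absorbs `x ↦ t` by the head equation, and then `σ` because it still solves the instantiated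
  -- tail.
  eliminate : ∀ {x t E} → ¬ (x ∈V t) → IdempotentMGU (map (substEq (x ↦ t)) E) →
              IdempotentMGU ((var x , t) ∷ E)
  eliminate {x} {t} x∉t (idempotentMGU σ u g) =
    idempotentMGU (x ↦ t ⨟ σ) (solved ∷ unifies-subst⁻ u) general
    where
    open ≡-Reasoning

    solved : (x ↦ t) x · σ ≡ t · (x ↦ t ⨟ σ)
    solved = begin
      (x ↦ t) x · σ      ≡⟨ cong (_· σ) (↦-≡ x t) ⟩
      t · σ              ≡⟨ cong (_· σ) (·-↦-∉V t x∉t) ⟨
      t · x ↦ t · σ      ≡⟨ ·-⨟ t (x ↦ t) σ ⟩
      t · (x ↦ t ⨟ σ)    ∎

    general : ∀ τ → Unifies τ ((var x , t) ∷ _) → τ Absorbs x ↦ t ⨟ σ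
    general τ (p ∷ ps) y = begin
      τ y                  ≡⟨ abs y ⟩
      (x ↦ t) y · τ        ≡⟨ absorbs-· (g τ (unifies-subst⁺ abs ps)) ((x ↦ t) y) ⟨
      (x ↦ t) y · σ · τ    ∎
      where abs = absorbs-↦ τ p

  pairs : ∀ {n} → Vec Term n → Vec Term n → List Equation
  pairs ts us = Vec.toList (Vec.zip ts us)

  pairs⁺ : ∀ {n σ} (ts us : Vec Term n) → ts ·* σ ≡ us ·* σ → Unifies σ (pairs ts us)
  pairs⁺ []       []       eq = []
  pairs⁺ (t ∷ ts) (u ∷ us) eq =
    cong Vec.head eq ∷ pairs⁺ ts us (cong Vec.tail eq)

  pairs⁻ : ∀ {n σ} (ts us : Vec Term n) → Unifies σ (pairs ts us) → ts ·* σ ≡ us ·* σ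
  pairs⁻ []       []       []       = refl
  pairs⁻ (t ∷ ts) (u ∷ us) (p ∷ ps) = cong₂ _∷_ p (pairs⁻ ts us ps)

  decompose : ∀ {f ts us E} → IdempotentMGU (pairs ts us ++ E) →
              IdempotentMGU ((fun f ts , fun f us) ∷ E)
  decompose {f} {ts} {us} = IdempotentMGU-resp
    (λ u → cong (fun f) (pairs⁻ ts us (All.++⁻ˡ (pairs ts us) u))
             ∷ All.++⁻ʳ (pairs ts us) u)
    (λ { (p ∷ ps) → All.++⁺ (pairs⁺ ts us (fun-injective p)) ps })

  -- For a unifier τ both sides of an equation have equally large instances, so
  -- counting the left-hand sides is enough.
  weight : Subst → List Equation → ℕ
  weight τ []            = 0
  weight τ ((s , t) ∷ E) = size (s · τ) + weight τ E

  -- Eliminating a variable leaves the instances under `τ` as they are, so an elimination step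
  -- lowers the weight by dropping its head equation.
  weight-subst : ∀ {θ τ} → τ Absorbs θ → ∀ E →
                 weight τ (map (substEq θ) E) ≡ weight τ E
  weight-subst abs []            = refl
  weight-subst abs ((s , t) ∷ E) =
    cong₂ _+_ (cong size (absorbs-· abs s)) (weight-subst abs E)

  weight-pairs : ∀ {n} τ (ts us : Vec Term n) E →
                 weight τ (pairs ts us ++ E) ≡ size* (ts ·* τ) + weight τ E
  weight-pairs τ []       []       E = refl
  weight-pairs τ (t ∷ ts) (u ∷ us) E =
    trans (cong (size (t · τ) +_) (weight-pairs τ ts us E))
          (sym (+-assoc (size (t · τ)) _ _))

  weight-tail : ∀ τ e E → weight τ E < weight τ (e ∷ E)
  weight-tail τ (s , t) E = m<n+m _ (size>0 (s · τ))

  mutual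
    -- The known unifier `τ` stays fixed throughout, and `n` is a strict bound on the weight that
    -- makes the recursion structural.
    solve : ∀ n E τ → Unifies τ E → weight τ E < n → IdempotentMGU E
    solve n []      τ []       w<n = idempotentMGU var [] λ _ _ _ → refl
    solve (suc n) ((var x , var y) ∷ E) τ (p ∷ ps) w<n with x ≟ y
    ... | yes refl = IdempotentMGU-resp (refl ∷_) All.tail
                       (solve n E τ ps
                         (<-≤-trans (weight-tail τ (var x , var y) E) (s≤s⁻¹ w<n)))
    ... | no  x≢y  = solveVar n E τ (λ { here → x≢y refl }) p ps w<n
    solve (suc n) ((var x , fun g us) ∷ E) τ (p ∷ ps) w<n =
      solveVar n E τ (unifier⇒∉V τ p) p ps w<n
    solve (suc n) ((fun f ts , var y) ∷ E) τ (p ∷ ps) w<n =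
      IdempotentMGU-resp flipHead flipHead
        (solveVar n E τ (unifier⇒∉V τ (sym p)) (sym p) ps
          -- Flipping changes which side is weighed; `p` says that the two instances coincide.
          (subst (λ u → size u + weight τ E < suc n) p w<n))
    solve (suc n) ((fun f ts , fun g us) ∷ E) τ (p ∷ ps) w<n with f Fin.≟ g
    ... | no  f≢g  = contradiction (root-≡ p) f≢g
      where
      root-≡ : ∀ {f g ts us} → fun f ts ≡ fun g us → f ≡ g
      root-≡ refl = refl
    ... | yes refl = decompose
                       (solve n (pairs ts us ++ E) τ
                         (All.++⁺ (pairs⁺ ts us (fun-injective p)) ps)
                         -- Removing the root symbol `f` lowers the weight by exactly one.
                         (≤-<-trans (≤-reflexive (weight-pairs τ ts us E)) (s≤s⁻¹ w<n)))

    solveVar : ∀ n {x t} E τ → ¬ (x ∈V t) → Unifier τ (var x) t → Unifies τ E →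
               weight τ ((var x , t) ∷ E) < suc n → IdempotentMGU ((var x , t) ∷ E)
    solveVar n {x} {t} E τ x∉t p ps w<n = eliminate x∉t
      (solve n (map (substEq (x ↦ t)) E) τ (unifies-subst⁺ abs ps)
        (≤-<-trans (≤-reflexive (weight-subst abs E))
                   (<-≤-trans (weight-tail τ (var x , t) E) (s≤s⁻¹ w<n))))
      where abs = absorbs-↦ τ p

  unifiable⇒MGU : ∀ s t τ → Unifier τ s t → Σ[ σ ∈ Subst ] MGU σ s t
  unifiable⇒MGU s t τ p =
    mgu m , All.head (unifies m) , λ τ′ p′ → τ′ , mostGeneral m τ′ (p′ ∷ [])
    where m = solve _ ((s , t) ∷ []) τ (p ∷ []) ≤-refl

  -- Renaming apart

  swap : 𝒱 → 𝒱 → 𝒱 → 𝒱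
  swap a b x with x ≟ a
  ... | yes _ = b
  ... | no  _ with x ≟ b
  ...   | yes _ = a
  ...   | no  _ = x

  swap-left : ∀ a b → swap a b a ≡ b
  swap-left a b with a ≟ a
  ... | yes _   = refl
  ... | no  a≢a = contradiction refl a≢a

  swap-right : ∀ a b → swap a b b ≡ a
  swap-right a b with b ≟ a
  ... | yes b≡a = b≡a
  ... | no  _ with b ≟ b
  ...   | yes _   = refl
  ...   | no  b≢b = contradiction refl b≢b

  swap-other : ∀ {a b x} → x ≢ a → x ≢ b → swap a b x ≡ x
  swap-other {a} {b} {x} x≢a x≢b with x ≟ a
  ... | yes x≡a = contradiction x≡a x≢a
  ... | no  _ with x ≟ b
  ...   | yes x≡b = contradiction x≡b x≢b
  ...   | no  _   = refl

  swap-involutive : ∀ a b x → swap a b (swap a b x) ≡ x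
  swap-involutive a b x with x ≟ a
  ... | yes refl = swap-right a b
  ... | no  x≢a with x ≟ b
  ...   | yes refl = swap-left a b
  ...   | no  x≢b  = swap-other x≢a x≢b

  transposition : 𝒱 → 𝒱 → Renaming
  transposition a b =
    mk↔ₛ′ (swap a b) (swap a b) (swap-involutive a b) (swap-involutive a b)

  -- A renaming is a bijection of all variables, so it is composed of transpositions, one for each
  -- variable of `xs`.
  avoid : ∀ xs ys → Σ[ ρ ∈ Renaming ] (∀ {x} → x ∈ xs → Inverse.to ρ x ∉ ys)
  avoid []       ys = ↔-refl , λ ()
  avoid (a ∷ xs) ys with avoid xs ys
  -- `z` must also miss the images of `xs`: otherwise the swap could move one of them to `to a`,
  -- which may lie in `ys`.
  ... | ρ , ρ∉ys with fresh (map (Inverse.to ρ) xs ++ ys)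
  ... | z , z∉ = ↔-trans ρ (transposition (to a) z) , avoids
    where
    open Inverse ρ using (to)

    z∉ys : z ∉ ys
    z∉ys = z∉ ∘ ∈-++⁺ʳ (map to xs)

    avoids : ∀ {x} → x ∈ a ∷ xs → swap (to a) z (to x) ∉ ys
    avoids (Any.here refl) ∈ys = z∉ys (subst (_∈ ys) (swap-left (to a) z) ∈ys)
    avoids {x} (Any.there x∈xs) ∈ys with to x ≟ to a
    ... | yes _ = z∉ys ∈ys
    ... | no  _ with to x ≟ z
    ...   | yes tox≡z = z∉ (subst (_∈ _) tox≡z (∈-++⁺ˡ (∈-map⁺ to x∈xs)))
    ...   | no  _     = ρ∉ys x∈xs ∈ys

  mutual
    ∈V-rename : ∀ {x} ρ t → x ∈V rename ρ t → ∃[ y ] y ∈V t × x ≡ Inverse.to ρ y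
    ∈V-rename ρ (var y)    here         = y , here , refl
    ∈V-rename ρ (fun f ts) (there i x∈) with ∈V-rename* ρ ts i x∈
    ... | y , y∈ , eq = y , there i y∈ , eq

    ∈V-rename* : ∀ {n x} ρ (ts : Vec Term n) i →
                 x ∈V lookup (ts ·* (var ∘ Inverse.to ρ)) i →
                 ∃[ y ] y ∈V lookup ts i × x ≡ Inverse.to ρ y
    ∈V-rename* ρ (t ∷ ts) zero    x∈ = ∈V-rename ρ t x∈
    ∈V-rename* ρ (t ∷ ts) (suc i) x∈ = ∈V-rename* ρ ts i x∈

  renameRule : Renaming → Rule → Rule
  renameRule ρ (ℓ ⟶ r) = rename ρ ℓ ⟶ rename ρ r

  ∈Vᴿ-rename : ∀ {x} ρ R → x ∈Vᴿ renameRule ρ R →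
               ∃[ y ] y ∈Vᴿ R × x ≡ Inverse.to ρ y
  ∈Vᴿ-rename ρ (ℓ ⟶ r) (inj₁ x∈) with ∈V-rename ρ ℓ x∈
  ... | y , y∈ , eq = y , inj₁ y∈ , eq
  ∈Vᴿ-rename ρ (ℓ ⟶ r) (inj₂ x∈) with ∈V-rename ρ r x∈
  ... | y , y∈ , eq = y , inj₂ y∈ , eq

  avoiding⇒disjoint : ∀ ρ ρ₁ ρ₂ →
    (∀ {x} → x ∈ ruleVars ρ₁ → Inverse.to ρ x ∉ ruleVars ρ₂) →
    VariableDisjoint (renameRule ρ ρ₁) ρ₂
  avoiding⇒disjoint ρ ρ₁ ρ₂ ρ∉ x x∈ρ₁ x∈ρ₂ with ∈Vᴿ-rename ρ ρ₁ x∈ρ₁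
  ... | y , y∈ρ₁ , refl =
    ρ∉ (∈Vᴿ⇒∈ruleVars ρ₁ y∈ρ₁) (∈Vᴿ⇒∈ruleVars ρ₂ x∈ρ₂)

  variant-refl : ∀ ρ → Variant ρ ρ
  variant-refl (ℓ ⟶ r) = ↔-refl , sym (·-var ℓ) , sym (·-var r)

  variant-trans : ∀ ρ₁ {ρ₂ ρ₃} → Variant ρ₁ ρ₂ → Variant ρ₂ ρ₃ → Variant ρ₁ ρ₃
  variant-trans (ℓ ⟶ r) (ρ , refl , refl) (ρ′ , refl , refl) =
    ↔-trans ρ ρ′ , ·-⨟ ℓ _ _ , ·-⨟ r _ _

  -- Root steps

  -- The equal left-hand sides make `σ` agree with `τ` after `ρ` on the variables of `ℓ`, among
  -- which are all those of `r`.
  variants-same-result : ∀ {ℓ r u v} σ τ → WellFormed (ℓ ⟶ r) →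
                         Variant (ℓ ⟶ r) (u ⟶ v) → ℓ · σ ≡ u · τ → r · σ ≡ v · τ
  variants-same-result {ℓ} {r} σ τ wf (ρ , refl , refl) eq =
    trans (·-cong r λ x x∈r → σ≗ρτ x (WellFormed.rhs-vars wf x x∈r))
          (sym (·-⨟ r _ τ))
    where
    σ≗ρτ : ∀ x → x ∈V ℓ → σ x ≡ τ (Inverse.to ρ x)
    σ≗ρτ = ·-cong⁻¹ (trans eq (·-⨟ ℓ _ τ))

  module _ (R : TRS) (nonOverlapping : NonOverlapping R) where

    root-same-result : ∀ {ℓ r u v} σ τ → (ℓ ⟶ r) ∈ rules R → (u ⟶ v) ∈ rules R →
                       ℓ · σ ≡ u · τ → r · σ ≡ v · τ
    root-same-result {ℓ} {r} {u} {v} σ τ ℓ→r∈R u→v∈R eq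
      with avoid (ruleVars (ℓ ⟶ r)) (ruleVars (u ⟶ v))
    -- Since term equality is decidable, the results may be assumed to differ. This yields the
    -- non-variance condition of a root overlap without deciding whether the rules are variants.
    ... | ρ , ρ∉ = decidable-stable ((r · σ) ≟ₜ (v · τ)) λ rσ≢vτ →
      nonOverlapping _ _
        (critical {π = []}
          (_ , ℓ→r∈R , ρ-variant)
          (_ , u→v∈R , variant-refl (u ⟶ v))
          (avoiding⇒disjoint ρ (ℓ ⟶ r) (u ⟶ v) ρ∉)
          refl
          (WellFormed.lhs-nonvar (All.lookup (wellFormed R) u→v∈R))
          (λ _ variant → rσ≢vτ
            (variants-same-result σ τ (All.lookup (wellFormed R) ℓ→r∈R)
              (variant-trans (ℓ ⟶ r) ρ-variant variant) eq))
          (proj₂ (unifiable⇒MGU (rename ρ ℓ) u υ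
            (trans renamed (trans eq (sym unrenamed))))))
      where
      open Inverse ρ using (to; from; strictlyInverseʳ)

      ρ-variant : Variant (ℓ ⟶ r) (renameRule ρ (ℓ ⟶ r))
      ρ-variant = ρ , refl , refl

      -- Glues the two matchers into one unifier: `τ` on the variables of `u ⟶ v`, and elsewhere `σ`
      -- after undoing `ρ`.
      υ : Subst
      υ x with x ∈? ruleVars (u ⟶ v)
      ... | yes _ = τ x
      ... | no  _ = σ (from x)

      υ-∈ : ∀ {x} → x ∈ ruleVars (u ⟶ v) → υ x ≡ τ x
      υ-∈ {x} x∈ with x ∈? ruleVars (u ⟶ v)
      ... | yes _  = refl
      ... | no  x∉ = contradiction x∈ x∉

      υ-∉ : ∀ {x} → x ∉ ruleVars (u ⟶ v) → υ x ≡ σ (from x)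
      υ-∉ {x} x∉ with x ∈? ruleVars (u ⟶ v)
      ... | yes x∈ = contradiction x∈ x∉
      ... | no  _  = refl

      unrenamed : u · υ ≡ u · τ
      unrenamed = ·-cong u λ x x∈u → υ-∈ (∈-++⁺ˡ (∈V⇒∈vars x∈u))

      renamed : rename ρ ℓ · υ ≡ ℓ · σ
      renamed = trans (·-⨟ ℓ _ υ) (·-cong ℓ λ x x∈ℓ →
        trans (υ-∉ (ρ∉ (∈-++⁺ˡ (∈V⇒∈vars x∈ℓ)))) (cong σ (strictlyInverseʳ x)))

    -- A step below the root would contract a redex at a proper position, which innermostness of `s`
    -- excludes.
    innermostRedex-step : ∀ {s t} → InnermostRedex R s → InnermostStep R s t →
      Σ[ ρ ∈ Rule ] Σ[ σ ∈ Subst ]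
        ρ ∈ rules R × s ≡ Rule.lhs ρ · σ × t ≡ Rule.rhs ρ · σ
    innermostRedex-step _ (step [] σ ρ∈R refl _ refl) = _ , σ , ρ∈R , refl , refl
    innermostRedex-step (_ , innermost) (step (i ∷ π) σ ρ∈R s∣π≡ (redex , _) _) =
      contradiction redex (innermost (i ∷ π) _ (λ ()) s∣π≡)

    -- Determinism of parallel-innermost rewriting

    parInnermost⇒reducible : ∀ {s t} → ParInnermost R s t → ¬ IsNormalForm (Step R) s
    -- Both constructors carry a nonempty innermost sequence, and its first step is an ordinary
    -- rewrite step from `s`.
    parInnermost⇒reducible par nf = nf (first (sequence par))
      where
      sequence : ∀ {s t} → ParInnermost R s t → TransClosure (InnermostStep R) s t
      sequence (root seq _ _) = seq
      sequence (args seq _ _) = seq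

      forget : ∀ {s t} → InnermostStep R s t → Step R s t
      forget (step π σ ρ∈R s∣π≡ _ t≡) = step π σ ρ∈R s∣π≡ t≡

      first : ∀ {s t} → TransClosure (InnermostStep R) s t → ∃ (Step R s)
      first [ s→t ]   = _ , forget s→t
      first (s→t ∷ _) = _ , forget s→t

    parInnermost-deterministic : Deterministic _≡_ (ParInnermost R)
    parInnermost-deterministic (root _ redex s→t) (root _ _ s→u)
      with innermostRedex-step redex s→t | innermostRedex-step redex s→u
    ... | _ , σ , ρ₁∈R , s≡ , refl | _ , τ , ρ₂∈R , s≡′ , refl =
      root-same-result σ τ ρ₁∈R ρ₂∈R (trans (sym s≡) s≡′)
    parInnermost-deterministic (root _ redex _) (args _ ¬redex _) =
      contradiction redex ¬redex
    parInnermost-deterministic (args _ ¬redex _) (root _ redex _) =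
      contradiction redex ¬redex
    parInnermost-deterministic {fun f ss} (args {ts = ts} _ _ ps) (args {ts = us} _ _ qs) =
      cong (fun f) (Pointwise-≡⇒≡ (ext same))
      where
      same : ∀ k → lookup ts k ≡ lookup us k
      same k with ps k | qs k
      ... | inj₁ p        | inj₁ q        = parInnermost-deterministic p q
      -- A shared argument cannot both take a parallel step and be a normal form.
      ... | inj₁ p        | inj₂ (_ , nf) = contradiction nf (parInnermost⇒reducible p)
      ... | inj₂ (_ , nf) | inj₁ q        = contradiction nf (parInnermost⇒reducible q)
      ... | inj₂ (eq , _) | inj₂ (eq′ , _) = trans (sym eq) eq′

corollary6p10 : (Sg : Signature) (Var : Variables) → let open Rewriting Sg Var in
    (R : TRS) → NonOverlapping R →
    Deterministic _≡_ (ParInnermost R) × Confluent (ParInnermost R)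
-- Under a deterministic relation, of two reduction sequences from one term one is a prefix of the
-- other, so they join at the end of the longer.
corollary6p10 Sg Var R nonOverlapping = deterministic , det⇒conf deterministic
  where
  open Rewriting Sg Var
  deterministic : Deterministic _≡_ (ParInnermost R)
  deterministic = parInnermost-deterministic Sg Var R nonOverlapping
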